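{- Let $q$ be a prime power and let $n \geq 2$ be an integer. Let $G_{\mathrm{pr}}(\mathbb{F}_q^n)$ be the phase-rotation distance graph, and let $\alpha(G_{\mathrm{pr}}(\mathbb{F}_q^n))$ be its independence number. Then \[ \alpha(G_{\mathrm{pr}}(\mathbb{F}_q^n)) \leq \begin{cases} 2^{n-1}\, \frac{n-1}{n} & \text{if } q=2 \text{ and } n \text{ is even}, \\ q^{n-1} & \text{if } q=2 \text{ and } n \text{ is odd, or } q \geq 3. \end{cases} \]
   Context: Let $\mathbf{e}_1,\ldots,\mathbf{e}_n$ be the standard basis of $\mathbb{F}_q^n$ and $\mathbf{1}$ the all-ones vector. Put $F_i=\mathrm{span}(\mathbf{e}_i)$ for $i=1,\ldots,n$ and $F_{n+1}=\mathrm{span}(\mathbf{1})$. The phase-rotation weight of $\mathbf{x}\in\mathbb{F}_q^n$ is $w_{\mathrm{pr}}(\mathbf{x})=\min\{|I| : I\subseteq\{1,\ldots,n+1\},\ \mathbf{x}\in\mathrm{span}(\bigcup_{i\in I}F_i)\}$, and the phase-rotation distance is $d_{\mathrm{pr}}(\mathbf{x},\mathbf{y})=w_{\mathrm{pr}}(\mathbf{x}-\mathbf{y})$. The phase-rotation distance graph $G_{\mathrm{pr}}(\mathbb{F}_q^n)$ is the graph with vertex set $\mathbb{F}_q^n$ in which $\mathbf{x},\mathbf{y}$ are adjacent if and only if $d_{\mathrm{pr}}(\mathbf{x},\mathbf{y})=1$. The independence number is the maximum size of a set of pairwise non-adjacent vertices. -}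

module Defs where

open import Algebra.Bundles using (CommutativeRing)
open import Data.Bool.Base using (if_then_else_)
open import Data.Fin.Base using (Fin; zero; suc; combine; finToFun; funToFin)
open import Data.Fin.Properties as Fin using (all?; any?; finToFun-funToFin; funToFin-finToFin)
open import Data.Fin.Subset as Subset using (Subset; ∣_∣; ⊤; ⊥)
open import Data.Fin.Subset.Properties as Subset using (anySubset?; _∈?_; ∣p∣≤n; ∣⊥∣≡0; ∉⊥; ∈⊤)
open import Data.Nat.Base as ℕ using (ℕ; zero; suc; _≤_; _^_; z≤n)
open import Data.Nat.Primality using (Prime)
import Data.Nat.Properties as ℕ
open import Data.Product using (∃; ∃-syntax; _×_; _,_; proj₁; proj₂)
open import Data.Sum.Base using (_⊎_; inj₁; inj₂)
open import Data.Vec.Functional using (Vector; _∷_; replicate)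
import Data.Vec.Functional.Relation.Binary.Equality.Setoid as VectorEquality
open import Function.Base using (_∘_)
open import Function.Bundles using (Inverse)
open import Level using (Level; _⊔_; 0ℓ) renaming (suc to lsuc)
open import Relation.Binary.Bundles using (Setoid)
open import Relation.Binary.Core using (Rel)
open import Relation.Binary.Definitions using (Symmetric; Irreflexive; _Respects₂_)
  renaming (Decidable to Decidable₂)
open import Relation.Binary.PropositionalEquality as ≡ using (_≡_)
open import Relation.Nullary.Decidable using (yes; no; map′; does; ¬?; _×-dec_; _→-dec_)
open import Relation.Nullary.Negation using (¬_; contradiction)
open import Relation.Unary using (Pred; Decidable; _∈_)

private
  variable
    a b c p ℓ : Level

IsPrimePower : ℕ → Set
IsPrimePower q = ∃[ p ] ∃[ k ] Prime p × 1 ≤ k × q ≡ p ^ k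

IsLeast : Pred ℕ p → Pred ℕ p
IsLeast P k = P k × (∀ {j} → P j → k ≤ j)

IsGreatest : Pred ℕ p → Pred ℕ p
IsGreatest P k = P k × (∀ {j} → P j → j ≤ k)

least : {P : Pred ℕ p} → Decidable P → ∃ P → ∃ (IsLeast P)
least {P = P} P? (k , Pk) = go P P? k Pk
  where
  go : ∀ (P : Pred ℕ p) → Decidable P → ∀ k → P k → ∃ (IsLeast P)
  go P P? k Pk with P? 0
  ... | yes P0 = 0 , P0 , λ _ → z≤n
  go P P? zero Pk | no ¬P0 = contradiction Pk ¬P0
  go P P? (suc k) Pk | no ¬P0 with go (P ∘ suc) (P? ∘ suc) k Pk
  ... | m , Pm , m≤ = suc m , Pm , bound
    where
    bound : ∀ {j} → P j → suc m ≤ j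
    bound {zero}  P0 = contradiction P0 ¬P0
    bound {suc j} Pj = ℕ.s≤s (m≤ Pj)

greatest : {P : Pred ℕ p} → Decidable P → ∃ P →
           ∀ b → (∀ {j} → P j → j ≤ b) → ∃ (IsGreatest P)
greatest {P = P} P? (k , Pk) = go
  where
  go : ∀ b → (∀ {j} → P j → j ≤ b) → ∃ (IsGreatest P)
  go b ≤b with P? b
  ... | yes Pb = b , Pb , ≤b
  go zero    ≤b | no ¬Pb = contradiction (≡.subst P (ℕ.n≤0⇒n≡0 (≤b Pk)) Pk) ¬Pb
  go (suc b) ≤b | no ¬Pb = go b λ {j} Pj →
    ℕ.≤-pred (ℕ.≤∧≢⇒< (≤b Pj) λ j≡ → ¬Pb (≡.subst P j≡ Pj))

isLeast-unique : {P : Pred ℕ a} {Q : Pred ℕ b} →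
                 (∀ {k} → P k → Q k) → (∀ {k} → Q k → P k) →
                 ∀ {k m} → IsLeast P k → IsLeast Q m → k ≡ m
isLeast-unique P⇒Q Q⇒P (Pk , k≤) (Qm , m≤) = ℕ.≤-antisym (k≤ (Q⇒P Qm)) (m≤ (P⇒Q Pk))

record FiniteGraph a b ℓ : Set (lsuc (a ⊔ b ⊔ ℓ)) where
  field
    vertices    : Setoid a b
    order       : ℕ
    enumeration : Inverse (≡.setoid (Fin order)) vertices

  open Setoid vertices public using () renaming (Carrier to Vertex; _≈_ to _≈ᵥ_)

  field
    Adjacent  : Rel Vertex ℓ
    adj-resp  : Adjacent Respects₂ _≈ᵥ_
    adj-irr   : Irreflexive _≈ᵥ_ Adjacent
    adj-sym   : Symmetric Adjacent
    adjacent? : Decidable₂ Adjacent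

  vertex : Fin order → Vertex
  vertex = Inverse.to enumeration

  -- A set of vertices is given by the set of indices of its members.
  Independent : Pred (Subset order) ℓ
  Independent S = ∀ i j → i Subset.∈ S → j Subset.∈ S → ¬ Adjacent (vertex i) (vertex j)

  IndependentOfSize : Pred ℕ ℓ
  IndependentOfSize k = ∃[ S ] ∣ S ∣ ≡ k × Independent S

  independent? : Decidable Independent
  independent? S = all? λ i → all? λ j →
    (i ∈? S) →-dec ((j ∈? S) →-dec ¬? (adjacent? (vertex i) (vertex j)))

  independenceNumber-exists : ∃ (IsGreatest IndependentOfSize)
  independenceNumber-exists = greatest
    (λ k → anySubset? λ S → (∣ S ∣ ℕ.≟ k) ×-dec independent? S)
    (0 , ⊥ , ∣⊥∣≡0 order , λ _ _ i∈⊥ → contradiction i∈⊥ ∉⊥)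
    order
    (λ { (S , ≡.refl , _) → ∣p∣≤n S })

  independenceNumber : ℕ
  independenceNumber = proj₁ independenceNumber-exists

  independenceNumber-isGreatest : IsGreatest IndependentOfSize independenceNumber
  independenceNumber-isGreatest = proj₂ independenceNumber-exists

record FiniteField c ℓ (q : ℕ) : Set (lsuc (c ⊔ ℓ)) where
  field
    commutativeRing : CommutativeRing c ℓ

  open CommutativeRing commutativeRing public

  field
    0≉1         : ¬ 0# ≈ 1#
    inverse     : ∀ x → ¬ x ≈ 0# → ∃[ y ] y * x ≈ 1#
    enumeration : Inverse (≡.setoid (Fin q)) setoid

module PhaseRotation {c ℓ q} (F : FiniteField c ℓ q) (n : ℕ) where

  open FiniteField F hiding (zero)
  open import Algebra.Properties.Ring ring
    using (-0#≈0#; -‿+-comm; -‿distribˡ-*; -‿involutive)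
  open import Algebra.Properties.Semiring.Sum semiring
    using (sum; sum-cong-≋; sum-replicate-zero)
  open import Algebra.Properties.CommutativeMonoid.Sum +-commutativeMonoid
    using (∑-distrib-+)
  open VectorEquality setoid public using (_≋_; ≋-refl; ≋-sym; ≋-trans; ≋-setoid)
  open import Relation.Binary.Reasoning.Setoid setoid

  𝔽ⁿ : Set c
  𝔽ⁿ = Vector Carrier n

  0ᵥ 𝟏 : 𝔽ⁿ
  0ᵥ = replicate n 0#
  𝟏  = replicate n 1#

  infixl 6 _+ᵥ_ _-ᵥ_
  infixr 7 _·ᵥ_

  _+ᵥ_ _-ᵥ_ : 𝔽ⁿ → 𝔽ⁿ → 𝔽ⁿ
  (x +ᵥ y) i = x i + y i
  (x -ᵥ y) i = x i - y i

  _·ᵥ_ : Carrier → 𝔽ⁿ → 𝔽ⁿ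
  (a ·ᵥ x) i = a * x i

  𝐞 : Fin n → 𝔽ⁿ
  𝐞 i j = if does (i Fin.≟ j) then 1# else 0#

  -- Finite linear combinations of members of S, built one term at a time.
  data Span {p} (S : Pred 𝔽ⁿ p) : Pred 𝔽ⁿ (c ⊔ ℓ ⊔ p) where
    empty : ∀ {x} → x ≋ 0ᵥ → Span S x
    add   : ∀ {x v y} (a : Carrier) → S v → Span S y → x ≋ a ·ᵥ v +ᵥ y → Span S x

  -- The all-ones direction, traditionally indexed n+1, comes first here.
  generator : Fin (suc n) → 𝔽ⁿ
  generator = 𝟏 ∷ 𝐞

  Line : Fin (suc n) → Pred 𝔽ⁿ (c ⊔ ℓ)
  Line i = Span (_≋ generator i)

  ⋃Lines : Subset (suc n) → Pred 𝔽ⁿ (c ⊔ ℓ)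
  ⋃Lines I v = ∃[ i ] i Subset.∈ I × v ∈ Line i

  SpannedBySize : 𝔽ⁿ → Pred ℕ (c ⊔ ℓ)
  SpannedBySize x k = ∃[ I ] ∣ I ∣ ≡ k × x ∈ Span (⋃Lines I)

  span-resp : ∀ {S : Pred 𝔽ⁿ p} {x y} → x ≋ y → Span S x → Span S y
  span-resp x≋y (empty x≋0)      = empty (≋-trans (≋-sym x≋y) x≋0)
  span-resp x≋y (add a Sv s x≋)  = add a Sv s (≋-trans (≋-sym x≋y) x≋)

  span-neg : ∀ {S : Pred 𝔽ⁿ p} {x} → Span S x → Span S (λ i → - x i)
  span-neg (empty x≋0) = empty λ i → trans (-‿cong (x≋0 i)) -0#≈0#
  span-neg {x = x} (add {v = v} {y} a Sv s x≋) = add (- a) Sv (span-neg s) λ i → begin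
    - x i                  ≈⟨ -‿cong (x≋ i) ⟩
    - (a * v i + y i)      ≈⟨ -‿+-comm (a * v i) (y i) ⟨
    - (a * v i) + - y i    ≈⟨ +-congʳ (-‿distribˡ-* a (v i)) ⟩
    - a * v i + - y i      ∎

  combination : Vector Carrier (suc n) → 𝔽ⁿ
  combination cs j = sum λ i → cs i * generator i j

  Coefficients : Subset (suc n) → 𝔽ⁿ → Pred (Vector Carrier (suc n)) ℓ
  Coefficients I x cs = (∀ i → ¬ i Subset.∈ I → cs i ≈ 0#) × x ≋ combination cs

  line⇒multiple : ∀ i {v} → v ∈ Line i → ∃[ a ] v ≋ a ·ᵥ generator i
  line⇒multiple i (empty v≋0) = 0# , λ j → trans (v≋0 j) (sym (zeroˡ _))
  line⇒multiple i {x} (add {v = v} {y} a v≋ s x≋) with line⇒multiple i s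
  ... | b , y≋ = a + b , λ j → begin
    x j                                      ≈⟨ x≋ j ⟩
    a * v j + y j                            ≈⟨ +-cong (*-congˡ (v≋ j)) (y≋ j) ⟩
    a * generator i j + b * generator i j    ≈⟨ distribʳ _ _ _ ⟨
    (a + b) * generator i j                  ∎

  single : ∀ {m} → Fin m → Carrier → Vector Carrier m
  single zero    a zero    = a
  single zero    a (suc j) = 0#
  single (suc i) a zero    = 0#
  single (suc i) a (suc j) = single i a j

  single-≢ : ∀ {m} (i j : Fin m) a → ¬ i ≡ j → single i a j ≈ 0#
  single-≢ zero    zero    a i≢j = contradiction ≡.refl i≢j
  single-≢ zero    (suc j) a i≢j = refl
  single-≢ (suc i) zero    a i≢j = refl
  single-≢ (suc i) (suc j) a i≢j = single-≢ i j a (i≢j ∘ ≡.cong suc)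

  sum-zero : ∀ {m} (g : Vector Carrier m) → sum (λ k → 0# * g k) ≈ 0#
  sum-zero {m} g = trans (sum-cong-≋ {m} λ k → zeroˡ (g k)) (sum-replicate-zero m)

  sum-single : ∀ {m} (i : Fin m) a (g : Vector Carrier m) →
               sum (λ k → single i a k * g k) ≈ a * g i
  sum-single zero    a g = trans (+-congˡ (sum-zero (g ∘ suc))) (+-identityʳ _)
  sum-single (suc i) a g = begin
    0# * g zero + sum (λ k → single i a k * g (suc k))  ≈⟨ +-cong (zeroˡ _) (sum-single i a (g ∘ suc)) ⟩
    0# + a * g (suc i)                                  ≈⟨ +-identityˡ _ ⟩
    a * g (suc i)                                       ∎

  span⇒coefficients : ∀ {I x} → x ∈ Span (⋃Lines I) → ∃ (Coefficients I x)
  span⇒coefficients (empty x≋0) =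
    replicate _ 0# , (λ _ _ → refl) , λ j → trans (x≋0 j) (sym (sum-zero λ i → generator i j))
  span⇒coefficients {I} {x} (add {v = v} {y} a (i , i∈I , v∈) s x≋)
    with line⇒multiple i v∈ | span⇒coefficients s
  ... | b , v≋ | cs , cs∉ , y≋ = ds , ds∉ , λ j → begin
    x j                                         ≈⟨ x≋ j ⟩
    a * v j + y j                               ≈⟨ +-cong (*-congˡ (v≋ j)) (y≋ j) ⟩
    a * (b * generator i j) + combination cs j  ≈⟨ +-congʳ (*-assoc _ _ _) ⟨
    a * b * generator i j + combination cs j    ≈⟨ +-congʳ (sum-single i (a * b) λ k → generator k j) ⟨
    combination (single i (a * b)) j + combination cs j
      ≈⟨ ∑-distrib-+ (λ k → single i (a * b) k * generator k j) (λ k → cs k * generator k j) ⟨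
    sum (λ k → single i (a * b) k * generator k j + cs k * generator k j)
      ≈⟨ sum-cong-≋ {suc n} (λ k → distribʳ (generator k j) (single i (a * b) k) (cs k)) ⟨
    combination ds j                            ∎
    where
    ds : Vector Carrier (suc n)
    ds k = single i (a * b) k + cs k
    ds∉ : ∀ k → ¬ k Subset.∈ I → ds k ≈ 0#
    ds∉ k k∉ = trans
      (+-cong (single-≢ i k _ λ i≡k → k∉ (≡.subst (Subset._∈ I) i≡k i∈I)) (cs∉ k k∉))
      (+-identityˡ 0#)

  sum-span : ∀ {S : Pred 𝔽ⁿ p} {m} (cs : Vector Carrier m) (g : Fin m → 𝔽ⁿ) →
             (∀ i → g i ∈ S ⊎ cs i ≈ 0#) → (λ j → sum λ i → cs i * g i j) ∈ Span S
  sum-span {m = zero}  cs g h = empty ≋-refl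
  sum-span {m = suc m} cs g h with h zero | sum-span (cs ∘ suc) (g ∘ suc) (h ∘ suc)
  ... | inj₁ g∈S | s = add (cs zero) g∈S s ≋-refl
  ... | inj₂ c≈0 | s = span-resp (λ j → sym (trans
    (+-congʳ (trans (*-congʳ c≈0) (zeroˡ _))) (+-identityˡ _))) s

  generator∈Line : ∀ i → generator i ∈ Line i
  generator∈Line i = add 1# ≋-refl (empty ≋-refl) λ j →
    sym (trans (+-identityʳ _) (*-identityˡ _))

  coefficients⇒span : ∀ {I x} → ∃ (Coefficients I x) → x ∈ Span (⋃Lines I)
  coefficients⇒span {I} (cs , cs∉ , x≋) = span-resp (≋-sym x≋) (sum-span cs generator h)
    where
    h : ∀ i → generator i ∈ ⋃Lines I ⊎ cs i ≈ 0#
    h i with i ∈? I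
    ... | yes i∈I = inj₁ (i , i∈I , generator∈Line i)
    ... | no  i∉I = inj₂ (cs∉ i i∉I)

  open Inverse enumeration
    using (to; from; from-cong; strictlyInverseˡ; strictlyInverseʳ)

  _≈?_ : Decidable₂ _≈_
  x ≈? y = map′
    (λ e → trans (sym (strictlyInverseˡ x)) (trans (reflexive (≡.cong to e)) (strictlyInverseˡ y)))
    from-cong
    (from x Fin.≟ from y)

  vectors : ∀ m → Inverse (≡.setoid (Fin (q ^ m))) (≋-setoid m)
  vectors m = record
    { to        = λ k i → to (finToFun {m = q} {n = m} k i)
    ; from      = λ x → funToFin (from ∘ x)
    ; to-cong   = λ { ≡.refl → ≋-refl }
    ; from-cong = λ x≋y → funToFin-cong (λ i → from-cong (x≋y i))
    ; inverse   =
        (λ { {x} ≡.refl i → trans (reflexive (≡.cong to (finToFun-funToFin (from ∘ x) i)))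
                                  (strictlyInverseˡ (x i)) })
      , (λ {k} {x} x≋ → ≡.trans
          (funToFin-cong λ i → ≡.trans (from-cong (x≋ i)) (strictlyInverseʳ _))
          (funToFin-finToFin {m} {q} k))
    }
    where
    funToFin-cong : ∀ {m r} {f g : Fin m → Fin r} → (∀ i → f i ≡ g i) → funToFin f ≡ funToFin g
    funToFin-cong {zero}  f≗g = ≡.refl
    funToFin-cong {suc m} f≗g = ≡.cong₂ combine (f≗g zero) (funToFin-cong (f≗g ∘ suc))

  coefficients? : ∀ I x → Decidable (Coefficients I x)
  coefficients? I x cs =
    (all? λ i → ¬? (i ∈? I) →-dec (cs i ≈? 0#)) ×-dec (all? λ j → x j ≈? combination cs j)

  coefficients-resp : ∀ {I x cs ds} → cs ≋ ds → Coefficients I x cs → Coefficients I x ds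
  coefficients-resp cs≋ds (cs∉ , x≋) =
      (λ i i∉ → trans (sym (cs≋ds i)) (cs∉ i i∉))
    , (λ j → trans (x≋ j) (sum-cong-≋ {suc n} λ i → *-congʳ {generator i j} (cs≋ds i)))

  span? : ∀ I → Decidable (Span (⋃Lines I))
  span? I x = map′
    (λ (k , h) → coefficients⇒span (V.to k , h))
    (λ s → let cs , h = span⇒coefficients s in
       V.from cs , coefficients-resp {I} (≋-sym (V.strictlyInverseˡ cs)) h)
    (any? λ k → coefficients? I x (V.to k))
    where module V = Inverse (vectors (suc n))

  x∈span⊤ : ∀ x → x ∈ Span (⋃Lines ⊤)
  x∈span⊤ x = coefficients⇒span (0# ∷ x , (λ i i∉ → contradiction ∈⊤ i∉) , λ j → sym (begin
    0# * 1# + sum (λ i → x i * 𝐞 i j)  ≈⟨ +-cong (zeroˡ _) (sum-cong-≋ {n} (λ i → trans (*-comm _ _) (*-congʳ (𝐞-single j i)))) ⟩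
    0# + sum (λ i → single j 1# i * x i) ≈⟨ +-identityˡ _ ⟩
    sum (λ i → single j 1# i * x i)    ≈⟨ sum-single j 1# x ⟩
    1# * x j                           ≈⟨ *-identityˡ _ ⟩
    x j                                ∎))
    where
    single-≡ : ∀ {m} (j : Fin m) a → single j a j ≈ a
    single-≡ zero    a = refl
    single-≡ (suc j) a = single-≡ j a
    𝐞-single : ∀ j i → 𝐞 i j ≈ single j 1# i
    𝐞-single j i with i Fin.≟ j
    ... | yes ≡.refl = sym (single-≡ j 1#)
    ... | no  i≢j    = sym (single-≢ j i 1# (i≢j ∘ ≡.sym))

  -- Spans are decidable by searching for coefficients, so the minimum exists.
  weight-exists : ∀ x → ∃ (IsLeast (SpannedBySize x))
  weight-exists x = least
    (λ k → anySubset? λ I → (∣ I ∣ ℕ.≟ k) ×-dec span? I x)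
    (∣ ⊤ {suc n} ∣ , ⊤ , ≡.refl , x∈span⊤ x)

  weight : 𝔽ⁿ → ℕ
  weight x = proj₁ (weight-exists x)

  weight-isLeast : ∀ x → IsLeast (SpannedBySize x) (weight x)
  weight-isLeast x = proj₂ (weight-exists x)

  distance : 𝔽ⁿ → 𝔽ⁿ → ℕ
  distance x y = weight (x -ᵥ y)

  weight-cong : ∀ {x y} → x ≋ y → weight x ≡ weight y
  weight-cong {x} {y} x≋y = isLeast-unique
    (λ (I , e , s) → I , e , span-resp x≋y s)
    (λ (I , e , s) → I , e , span-resp (≋-sym x≋y) s)
    (weight-isLeast x) (weight-isLeast y)

  weight-neg : ∀ x → weight (λ i → - x i) ≡ weight x
  weight-neg x = isLeast-unique
    (λ (I , e , s) → I , e , span-resp (λ i → -‿involutive (x i)) (span-neg s))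
    (λ (I , e , s) → I , e , span-neg s)
    (weight-isLeast _) (weight-isLeast x)

  distance-cong : ∀ {x x′ y y′} → x ≋ x′ → y ≋ y′ → distance x y ≡ distance x′ y′
  distance-cong x≋ y≋ = weight-cong λ i → +-cong (x≋ i) (-‿cong (y≋ i))

  distance-sym : ∀ x y → distance x y ≡ distance y x
  distance-sym x y = ≡.trans
    (weight-cong λ i → begin
      x i - y i          ≈⟨ +-comm _ _ ⟩
      - y i + x i        ≈⟨ +-congˡ (-‿involutive (x i)) ⟨
      - y i + - - x i    ≈⟨ -‿+-comm _ _ ⟩
      - (y i - x i)      ∎)
    (weight-neg (y -ᵥ x))

  distance-zero : ∀ {x y} → x ≋ y → distance x y ≡ 0
  distance-zero {x} {y} x≋y = ℕ.n≤0⇒n≡0 (proj₂ (weight-isLeast (x -ᵥ y))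
    ( ⊥ , ∣⊥∣≡0 (suc n)
    , empty λ i → trans (+-congʳ (x≋y i)) (-‿inverseʳ (y i))))

  graph : FiniteGraph c ℓ 0ℓ
  graph = record
    { vertices    = ≋-setoid n
    ; order       = q ^ n
    ; enumeration = vectors n
    ; Adjacent    = λ x y → distance x y ≡ 1
    ; adj-resp    = (λ {x} y≋ d → ≡.trans (distance-cong {x} ≋-refl (≋-sym y≋)) d)
                  , (λ {y} x≋ d → ≡.trans (distance-cong {y = y} (≋-sym x≋) ≋-refl) d)
    ; adj-irr     = λ x≋y d → contradiction (≡.trans (≡.sym (distance-zero x≋y)) d) λ ()
    ; adj-sym     = λ {x} {y} d → ≡.trans (distance-sym y x) d
    ; adjacent?   = λ x y → distance x y ℕ.≟ 1
    }

Gpr : ∀ {c ℓ q} → FiniteField c ℓ q → ℕ → FiniteGraph c ℓ 0ℓ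
Gpr F n = PhaseRotation.graph F n

α : ∀ {a b ℓ} → FiniteGraph a b ℓ → ℕ
α = FiniteGraph.independenceNumber

{-# OPTIONS --safe #-}

-- Both bounds come from averaging over translates of a fixed vertex set: if every translate
-- of W meets an independent set S in at most r points, then |W| |S| ≤ r qⁿ.
--
-- In general, take W to be the line spanned by the first basis vector, which is a clique (r = 1).
--
-- For q = 2 and n even, put pₖ = e₁ + ⋯ + eₖ and let W consist of the 2n vectors pₖ and pₖ + 𝟏
-- with k < n. They form a Möbius ladder: the cycle runs p₀, …, pₙ = p₀ + 𝟏, …, pₙ + 𝟏 = p₀ and
-- the rungs join pₖ to pₖ + 𝟏. An independent set with n points in it would contain exactly one
-- end of each rung and alternate along the cycle, hence, n being even, treat p₀ and
-- pₙ = p₀ + 𝟏 alike, against the rung at p₀. So r = n − 1.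
module Submission where

open import Defs
open import Data.Bool.Base using (Bool; true; false; not; if_then_else_)
open import Data.Bool.Properties using (not-involutive)
open import Data.Fin.Base using (Fin; zero; suc; toℕ; fromℕ<)
import Data.Fin.Properties as Fin
open import Data.Fin.Permutation using (Permutation; permutation)
open import Data.Fin.Subset using (Subset; ∣_∣; ⁅_⁆) renaming (_-_ to _∖_)
open import Data.Fin.Subset.Properties using (∣⁅x⁆∣≡1; x∈⁅x⁆; p⊂q⇒∣p∣<∣q∣; x∈p⇒p-x⊂p)
open import Data.Integer.Base using (+_)
import Data.Integer.Base as ℤ
import Data.Integer.Properties as ℤ
open import Data.Nat.Base as ℕ using (ℕ; zero; suc; NonZero; _≤_; _<_; _^_; _∸_; z≤n; s≤s)
open import Data.Nat.Divisibility using (_∣_; divides)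
import Data.Nat.Properties as ℕ
open import Data.Nat.Solver using (module +-*-Solver)
open import Data.Product using (_×_; _,_; proj₁; proj₂)
open import Data.Rational.Base as ℚ using (_/_)
import Data.Rational.Properties as ℚ
import Data.Rational.Unnormalised.Base as ℚᵘ
import Data.Rational.Unnormalised.Properties as ℚᵘ
open import Data.Sum.Base using (_⊎_; inj₁; inj₂; [_,_]′)
open import Data.Vec.Base using ([]; _∷_; lookup)
open import Data.Vec.Functional using (Vector)
open import Data.Vec.Properties using (lookup⇒[]=)
open import Function.Base using (_∘_)
open import Function.Bundles using (Inverse)
open import Relation.Binary.PropositionalEquality as ≡ using (_≡_; cong; cong₂)
open import Relation.Nullary.Decidable using (yes; no; does)
open import Relation.Nullary.Negation using (¬_; contradiction)
open import Relation.Unary using (_∈_)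

open import Algebra.Properties.CommutativeMonoid.Sum ℕ.+-0-commutativeMonoid
  using (sum; sum-cong-≗; sum-permute; ∑-comm; ∑-distrib-+)

-- Sums of indicators and double counting.

indicator : Bool → ℕ
indicator b = if b then 1 else 0

≤1⇒≡0⊎≡1 : ∀ {k} → k ≤ 1 → k ≡ 0 ⊎ k ≡ 1
≤1⇒≡0⊎≡1 z≤n       = inj₁ ≡.refl
≤1⇒≡0⊎≡1 (s≤s z≤n) = inj₂ ≡.refl

sum-const : ∀ {m} {f : Vector ℕ m} {r} → (∀ i → f i ≡ r) → sum f ≡ m ℕ.* r
sum-const {zero}  f≡r = ≡.refl
sum-const {suc m} f≡r = cong₂ ℕ._+_ (f≡r zero) (sum-const (f≡r ∘ suc))

sum-bounded : ∀ {m} {f : Vector ℕ m} {r} → (∀ i → f i ≤ r) → sum f ≤ m ℕ.* r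
sum-bounded {zero}  f≤r = z≤n
sum-bounded {suc m} f≤r = ℕ.+-mono-≤ (f≤r zero) (sum-bounded (f≤r ∘ suc))

sum-indicator-unique : ∀ {m} (b : Fin m → Bool) →
                       (∀ i j → b i ≡ true → b j ≡ true → i ≡ j) →
                       sum (indicator ∘ b) ≤ 1
sum-indicator-unique {zero}  b unique = z≤n
sum-indicator-unique {suc m} b unique with b zero in b₀
... | false = sum-indicator-unique (b ∘ suc)
  λ i j bᵢ bⱼ → Fin.suc-injective (unique (suc i) (suc j) bᵢ bⱼ)
... | true  = ℕ.≤-reflexive (cong suc (≡.trans (sum-const rest) (ℕ.*-zeroʳ m)))
  where
  rest : ∀ i → indicator (b (suc i)) ≡ 0
  rest i with b (suc i) in bᵢ
  ... | false = ≡.refl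
  ... | true  = contradiction (unique zero (suc i) b₀ bᵢ) λ ()

-- An entry 0 falls short at once; after an entry 1 the tail still cannot consist of ones alone.
sum<length : ∀ {m} (t : Vector ℕ m) → (∀ i → t i ≤ 1) → ¬ (∀ i → t i ≡ 1) → sum t < m
sum<length {zero}  t t≤1 ¬t≡1 = contradiction (λ ()) ¬t≡1
sum<length {suc m} t t≤1 ¬t≡1 with t zero in t₀ | t≤1 zero
... | 0 | _ = s≤s (ℕ.≤-trans (sum-bounded (t≤1 ∘ suc)) (ℕ.≤-reflexive (ℕ.*-identityʳ m)))
... | 1 | _ = s≤s (sum<length (t ∘ suc) (t≤1 ∘ suc)
  λ t≡1 → ¬t≡1 λ { zero → t₀ ; (suc i) → t≡1 i })
... | suc (suc _) | s≤s ()

∣p∣≡sum : ∀ {m} (p : Subset m) → ∣ p ∣ ≡ sum (indicator ∘ lookup p)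
∣p∣≡sum []          = ≡.refl
∣p∣≡sum (true  ∷ p) = cong suc (∣p∣≡sum p)
∣p∣≡sum (false ∷ p) = ∣p∣≡sum p

-- Double counting: `k` runs over the points (or rungs) of the fixed set W, `x` over the translates,
-- and `g k x` counts what part `k` of translate `x` contributes to the independent set.
averaging : ∀ {m v w r} (g : Fin m → Fin v → ℕ) → (∀ k → sum (g k) ≡ w) →
            (∀ x → sum (λ k → g k x) ≤ r) → m ℕ.* w ≤ v ℕ.* r
averaging {m} {v} {w} {r} g ∑≡w ∑≤r = begin
  m ℕ.* w                        ≡⟨ sum-const ∑≡w ⟨
  sum (λ k → sum (g k))          ≡⟨ ∑-comm g ⟩
  sum (λ x → sum (λ k → g k x))  ≤⟨ sum-bounded ∑≤r ⟩
  v ℕ.* r                        ∎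
  where open ℕ.≤-Reasoning

-- Boolean alternation.

alternating : ∀ (a : ℕ → Bool) {n} → 2 ∣ n → (∀ k → k < n → a (suc k) ≡ not (a k)) → a n ≡ a 0
alternating a (divides m ≡.refl) = go m
  where
  go : ∀ m → (∀ k → k < m ℕ.* 2 → a (suc k) ≡ not (a k)) → a (m ℕ.* 2) ≡ a 0
  go zero    step = ≡.refl
  go (suc m) step = begin
    a (2 ℕ.+ m ℕ.* 2)        ≡⟨ step (suc (m ℕ.* 2)) ℕ.≤-refl ⟩
    not (a (suc (m ℕ.* 2)))  ≡⟨ cong not (step (m ℕ.* 2) (ℕ.n≤1+n _)) ⟩
    not (not (a (m ℕ.* 2)))  ≡⟨ not-involutive _ ⟩
    a (m ℕ.* 2)              ≡⟨ go m (λ k k< → step k (ℕ.m≤n⇒m≤1+n (ℕ.m≤n⇒m≤1+n k<))) ⟩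
    a 0                      ∎
    where open ≡.≡-Reasoning

NotBoth : Bool → Bool → Set
NotBoth a b = a ≡ true → ¬ b ≡ true

notBoth⇒≤1 : ∀ a b → NotBoth a b → indicator a ℕ.+ indicator b ≤ 1
notBoth⇒≤1 true  true  h = contradiction ≡.refl (h ≡.refl)
notBoth⇒≤1 true  false h = s≤s z≤n
notBoth⇒≤1 false true  h = s≤s z≤n
notBoth⇒≤1 false false h = z≤n

exactlyOne⇒not : ∀ a b → indicator a ℕ.+ indicator b ≡ 1 → b ≡ not a
exactlyOne⇒not true  true  ()
exactlyOne⇒not true  false _ = ≡.refl
exactlyOne⇒not false true  _ = ≡.refl
exactlyOne⇒not false false ()

notBoth-not⇒not : ∀ a b → NotBoth a b → NotBoth (not a) (not b) → b ≡ not a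
notBoth-not⇒not true  true  h _ = contradiction ≡.refl (h ≡.refl)
notBoth-not⇒not true  false _ _ = ≡.refl
notBoth-not⇒not false true  _ _ = ≡.refl
notBoth-not⇒not false false _ h = contradiction ≡.refl (h ≡.refl)

-- Finite fields and characteristic two.

module _ {c ℓ q} (F : FiniteField c ℓ q) where

  open FiniteField F hiding (zero)

  from-injective : ∀ {x y} → Inverse.from enumeration x ≡ Inverse.from enumeration y → x ≈ y
  from-injective {x} {y} eq = trans (sym (strictlyInverseˡ x))
    (trans (reflexive (cong to eq)) (strictlyInverseˡ y))
    where open Inverse enumeration

-- If 1 + 1 were 1, then 1 would be 0. With only two elements, 1 + 1 is therefore 0; `case` checks
-- this on the indices in `Fin 2`.
char2 : ∀ {c ℓ} (F : FiniteField c ℓ 2) → let open FiniteField F in 1# + 1# ≈ 0#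
char2 F = case (from 0#) (from 1#) (from (1# + 1#))
    (0≉1 ∘ from-injective F)
    (λ eq → 0≉1 (sym (identityʳ-unique 1# 1# (from-injective F eq))))
    (from-injective F)
  where
  open FiniteField F hiding (zero)
  open import Algebra.Properties.Group +-group using (identityʳ-unique)
  open Inverse enumeration using (from)
  case : ∀ (a b c : Fin 2) → ¬ a ≡ b → ¬ c ≡ b → (c ≡ a → 1# + 1# ≈ 0#) → 1# + 1# ≈ 0#
  case zero       zero       _          a≢b _   _ = contradiction ≡.refl a≢b
  case zero       (suc zero) zero       _   _   h = h ≡.refl
  case zero       (suc zero) (suc zero) _   c≢b _ = contradiction ≡.refl c≢b
  case (suc zero) zero       zero       _   c≢b _ = contradiction ≡.refl c≢b
  case (suc zero) zero       (suc zero) _   _   h = h ≡.refl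
  case (suc zero) (suc zero) _          a≢b _   _ = contradiction ≡.refl a≢b

-- Vectors of small weight, generators and prefixes.

module PhaseRotationProperties {c ℓ q} (F : FiniteField c ℓ q) (n : ℕ) where

  open FiniteField F hiding (zero)
  open PhaseRotation F n
  open import Algebra.Properties.AbelianGroup +-abelianGroup
    using (∙-cancelʳ; ∙-cancelˡ; identityʳ-unique; xyx⁻¹≈y)
  private module V = Inverse (vectors n)

  multiple∈Line : ∀ {x} i a → x ≋ a ·ᵥ generator i → x ∈ Line i
  multiple∈Line i a x≋ = add a ≋-refl (empty ≋-refl) λ j → trans (x≋ j) (sym (+-identityʳ _))

  line⇒weight≤1 : ∀ {x i} → x ∈ Line i → weight x ≤ 1
  line⇒weight≤1 {x} {i} x∈ = proj₂ (weight-isLeast x)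
    (⁅ i ⁆ , ∣⁅x⁆∣≡1 i , add 1# (i , x∈⁅x⁆ i , x∈) (empty ≋-refl)
      λ j → sym (trans (+-identityʳ _) (*-identityˡ _)))

  spannedBySize0⇒≋0 : ∀ {x} → SpannedBySize x 0 → x ≋ 0ᵥ
  spannedBySize0⇒≋0 (_ , _    , empty x≋0)             = x≋0
  -- A term of the combination needs an index in `I`, and deleting it would leave a set of size
  -- below 0.
  spannedBySize0⇒≋0 (I , ∣I∣≡0 , add _ (i , i∈I , _) _ _) = contradiction
    (≡.subst (∣ I ∖ i ∣ <_) ∣I∣≡0 (p⊂q⇒∣p∣<∣q∣ (x∈p⇒p-x⊂p i∈I))) λ ()

  weight≡0⇒≋0 : ∀ {x} → weight x ≡ 0 → x ≋ 0ᵥ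
  weight≡0⇒≋0 {x} w≡0 =
    spannedBySize0⇒≋0 (≡.subst (SpannedBySize x) w≡0 (proj₁ (weight-isLeast x)))

  -ᵥ≋0⇒≋ : ∀ {x y} → x -ᵥ y ≋ 0ᵥ → x ≋ y
  -ᵥ≋0⇒≋ {x} {y} h i = ∙-cancelʳ (- y i) (x i) (y i) (trans (h i) (sym (-‿inverseʳ (y i))))

  generator-suc≉0 : ∀ i → ¬ generator (suc i) ≋ 0ᵥ
  generator-suc≉0 i g≋0 with i Fin.≟ i | g≋0 i
  ... | yes _  | 1≈0 = 0≉1 (sym 1≈0)
  ... | no i≢i | _   = i≢i ≡.refl

  generator-zero≉0 : Fin n → ¬ generator zero ≋ 0ᵥ
  generator-zero≉0 i g≋0 = 0≉1 (sym (g≋0 i))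

  -- The vector pₖ.
  prefix : ∀ {m} → ℕ → Vector Carrier m
  prefix zero    _       = 0#
  prefix (suc k) zero    = 1#
  prefix (suc k) (suc j) = prefix k j

  prefix-full : ∀ m (j : Fin m) → prefix m j ≈ 1#
  prefix-full (suc m) zero    = refl
  prefix-full (suc m) (suc j) = prefix-full m j

  -- Consecutive prefixes differ by a basis vector. The `if` is `𝐞` unfolded, so that the dimension
  -- `m` can vary in the induction.
  prefix-suc : ∀ {m k} (k<m : k < m) (j : Fin m) →
               prefix (suc k) j ≈ prefix k j + (if does (fromℕ< k<m Fin.≟ j) then 1# else 0#)
  prefix-suc {suc m} {zero}  _         zero    = sym (+-identityˡ 1#)
  prefix-suc {suc m} {zero}  _         (suc j) = sym (+-identityˡ 0#)
  prefix-suc {suc m} {suc k} _         zero    = sym (+-identityʳ 1#)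
  prefix-suc {suc m} {suc k} (s≤s k<m) (suc j) = prefix-suc k<m j

  -- Translates and independent sets.

  module _ (S : Subset (q ^ n)) where

    member : 𝔽ⁿ → Bool
    member x = lookup S (V.from x)

    member-cong : ∀ {x y} → x ≋ y → member x ≡ member y
    member-cong x≋y = cong (lookup S) (V.from-cong x≋y)

    translation : 𝔽ⁿ → Permutation (q ^ n) (q ^ n)
    translation d = permutation
      (λ i → V.from (V.to i +ᵥ d))
      (λ i → V.from (V.to i -ᵥ d))
      (λ i → ≡.trans
        (V.from-cong λ j → trans (+-congʳ (V.strictlyInverseˡ _ j)) (cancel⁻ _ _))
        (V.strictlyInverseʳ i))
      (λ i → ≡.trans
        (V.from-cong λ j → trans (+-congʳ (V.strictlyInverseˡ _ j)) (cancel⁺ _ _))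
        (V.strictlyInverseʳ i))
      where
      cancel⁻ : ∀ a b → a - b + b ≈ a
      cancel⁻ a b = trans (+-assoc a (- b) b) (trans (+-congˡ (-‿inverseˡ b)) (+-identityʳ a))
      cancel⁺ : ∀ a b → a + b - b ≈ a
      cancel⁺ a b = trans (+-assoc a b (- b)) (trans (+-congˡ (-‿inverseʳ b)) (+-identityʳ a))

    -- Translation by `d` permutes the vertices.
    sum-translate : ∀ d → sum (λ i → indicator (member (V.to i +ᵥ d))) ≡ ∣ S ∣
    sum-translate d = ≡.trans
      (≡.sym (sum-permute (indicator ∘ lookup S) (translation d)))
      (≡.sym (∣p∣≡sum S))

    module _ (indep : FiniteGraph.Independent graph S) where

      -- A difference on a line has weight at most 1. Weight 1 would make two members of `S`
      -- adjacent, so the weight is 0.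
      collinear⇒≋ : ∀ {x y} i → (x -ᵥ y) ∈ Line i → member x ≡ true → member y ≡ true → x ≋ y
      collinear⇒≋ {x} {y} i x-y∈ x∈S y∈S = [ -ᵥ≋0⇒≋ ∘ weight≡0⇒≋0 , (λ w≡1 → contradiction
        (≡.trans (distance-cong (V.strictlyInverseˡ x) (V.strictlyInverseˡ y)) w≡1)
        (indep (V.from x) (V.from y) (lookup⇒[]= _ S x∈S) (lookup⇒[]= _ S y∈S))) ]′
        (≤1⇒≡0⊎≡1 (line⇒weight≤1 {i = i} x-y∈))

      -- Were both ends in `S`, they would coincide and the generator joining them would vanish.
      step-notBoth : ∀ x {y} i → ¬ generator i ≋ 0ᵥ → y ≋ x +ᵥ generator i →
                     NotBoth (member x) (member y)
      step-notBoth x {y} i g≉0 y≋ x∈S y∈S = g≉0 λ j →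
        identityʳ-unique (x j) (generator i j) (trans (sym (y≋ j)) (y≋x j))
        where
        y≋x : y ≋ x
        y≋x = collinear⇒≋ i (multiple∈Line i 1# λ j →
          trans (+-congʳ (y≋ j)) (trans (xyx⁻¹≈y (x j) _) (sym (*-identityˡ _)))) y∈S x∈S

      -- Points of a translated line differ by an element of `Line (suc e)`, so at most one of them
      -- is in `S`.
      line-bound : Fin n → q ℕ.* ∣ S ∣ ≤ q ^ n ℕ.* 1
      line-bound e = averaging
        (λ k i → indicator (member (V.to i +ᵥ to k ·ᵥ 𝐞 e)))
        (λ k → sum-translate (to k ·ᵥ 𝐞 e))
        (λ i → sum-indicator-unique _ λ k l k∈S l∈S → unique (V.to i) k l
          (collinear⇒≋ (suc e)
            (multiple∈Line (suc e) (to k - to l) (difference (V.to i) (to k) (to l)))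
            k∈S l∈S))
        where
        open Inverse enumeration using (to; from-cong; strictlyInverseʳ)
        open import Relation.Binary.Reasoning.Setoid setoid
        open import Algebra.Properties.Ring ring using (-‿distribˡ-*; -‿+-comm)
        difference : ∀ x a b → (x +ᵥ a ·ᵥ 𝐞 e) -ᵥ (x +ᵥ b ·ᵥ 𝐞 e) ≋ (a - b) ·ᵥ 𝐞 e
        difference x a b j = begin
          x j + s - (x j + t)            ≈⟨ +-cong (+-comm (x j) s) (sym (-‿+-comm (x j) t)) ⟩
          s + x j + (- x j - t)          ≈⟨ +-assoc s (x j) _ ⟩
          s + (x j + (- x j - t))        ≈⟨ +-congˡ (+-assoc (x j) (- x j) (- t)) ⟨
          s + (x j - x j - t)            ≈⟨ +-congˡ (+-congʳ (-‿inverseʳ (x j))) ⟩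
          s + (0# - t)                   ≈⟨ +-congˡ (+-identityˡ (- t)) ⟩
          s - t                          ≈⟨ +-congˡ (-‿distribˡ-* b (𝐞 e j)) ⟩
          a * 𝐞 e j + - b * 𝐞 e j        ≈⟨ distribʳ (𝐞 e j) a (- b) ⟨
          (a - b) * 𝐞 e j                ∎
          where
          s = a * 𝐞 e j
          t = b * 𝐞 e j
        scalar : ∀ a b → a * 𝐞 e e ≈ b * 𝐞 e e → a ≈ b
        scalar a b eq with e Fin.≟ e
        ... | yes _  = trans (sym (*-identityʳ a)) (trans eq (*-identityʳ b))
        ... | no e≢e = contradiction ≡.refl e≢e
        unique : ∀ x k l → x +ᵥ to k ·ᵥ 𝐞 e ≋ x +ᵥ to l ·ᵥ 𝐞 e → k ≡ l
        unique x k l eq = ≡.trans (≡.sym (strictlyInverseʳ k)) (≡.trans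
          (from-cong (scalar (to k) (to l) (∙-cancelˡ (x e) _ _ (eq e))))
          (strictlyInverseʳ l))

      -- The Möbius ladder; `e` witnesses that n is positive.

      module _ (1+1≈0 : 1# + 1# ≈ 0#) (2∣n : 2 ∣ n) (e : Fin n) where

        rung : 𝔽ⁿ → ℕ → ℕ
        rung x k = indicator (member (x +ᵥ prefix k)) ℕ.+ indicator (member (x +ᵥ prefix k +ᵥ 𝟏))

        rung≤1 : ∀ x k → rung x k ≤ 1
        rung≤1 x k = notBoth⇒≤1 _ _
          (step-notBoth (x +ᵥ prefix k) zero (generator-zero≉0 e) ≋-refl)

        -- Since pₙ is `𝟏`, one side of the ladder ends where the other begins.
        ladder-twist : ∀ x → member (x +ᵥ prefix n) ≡ member (x +ᵥ prefix 0 +ᵥ 𝟏)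
        ladder-twist x = member-cong λ j →
          trans (+-congˡ (prefix-full n j)) (+-congʳ (sym (+-identityʳ (x j))))

        ladder-twist′ : ∀ x → member (x +ᵥ prefix n +ᵥ 𝟏) ≡ member (x +ᵥ prefix 0)
        ladder-twist′ x = member-cong λ j →
          trans (+-congʳ (+-congˡ (prefix-full n j)))
          (trans (+-assoc (x j) 1# 1#) (+-congˡ 1+1≈0))

        not-all-rungs : ∀ x → ¬ (∀ (i : Fin n) → rung x (toℕ i) ≡ 1)
        not-all-rungs x full = absurd (≡.trans (≡.sym across-rung) a₀)
          where
          a a′ : ℕ → Bool
          a  k = member (x +ᵥ prefix k)
          a′ k = member (x +ᵥ prefix k +ᵥ 𝟏)

          a′≡not : ∀ k → k < n → a′ k ≡ not (a k)
          a′≡not k k<n = exactlyOne⇒not (a k) (a′ k)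
            (≡.subst (λ k → rung x k ≡ 1) (Fin.toℕ-fromℕ< k<n) (full (fromℕ< k<n)))

          0<n : 0 < n
          0<n = ℕ.≤-<-trans z≤n (Fin.toℕ<n e)

          -- Rung n is rung 0 with its ends exchanged; `flip` needs it when k is n - 1.
          a′≡not-last : a′ n ≡ not (a n)
          a′≡not-last = begin
            a′ n            ≡⟨ ladder-twist′ x ⟩
            a 0            ≡⟨ not-involutive (a 0) ⟨
            not (not (a 0)) ≡⟨ cong not (a′≡not 0 0<n) ⟨
            not (a′ 0)      ≡⟨ cong not (ladder-twist x) ⟨
            not (a n)       ∎
            where open ≡.≡-Reasoning

          a′≡not⁺ : ∀ k → k ≤ n → a′ k ≡ not (a k)
          a′≡not⁺ k k≤n with ℕ.m≤n⇒m<n∨m≡n k≤n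
          ... | inj₁ k<n    = a′≡not k k<n
          ... | inj₂ ≡.refl = a′≡not-last

          flip : ∀ k → k < n → a (suc k) ≡ not (a k)
          flip k k<n = notBoth-not⇒not (a k) (a (suc k))
            (step-notBoth _ (suc (fromℕ< k<n)) (generator-suc≉0 (fromℕ< k<n)) λ j →
              trans (+-congˡ (prefix-suc k<n j)) (sym (+-assoc _ _ _)))
            -- The parallel edge, shifted by `𝟏`: as each rung has exactly one end in `S`, it
            -- excludes that `a k` and `a (suc k)` are both false.
            (≡.subst₂ NotBoth (a′≡not k k<n) (a′≡not⁺ (suc k) k<n)
              (step-notBoth _ (suc (fromℕ< k<n)) (generator-suc≉0 (fromℕ< k<n)) λ j →
                trans (+-congʳ (trans (+-congˡ (prefix-suc k<n j)) (sym (+-assoc _ _ _))))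
                (trans (+-assoc _ _ _) (trans (+-congˡ (+-comm _ _)) (sym (+-assoc _ _ _))))))

          a₀ : a n ≡ a 0
          a₀ = alternating a 2∣n flip

          across-rung : a n ≡ not (a 0)
          across-rung = ≡.trans (ladder-twist x) (a′≡not 0 0<n)

          absurd : ∀ {b} → ¬ not b ≡ b
          absurd {true}  ()
          absurd {false} ()

        ladder-bound : n ℕ.* (∣ S ∣ ℕ.+ ∣ S ∣) ≤ q ^ n ℕ.* (n ∸ 1)
        ladder-bound = averaging {n} {q ^ n}
          (λ k i → rung (V.to i) (toℕ k))
          (λ k → ≡.trans
            (∑-distrib-+ (λ i → indicator (member (V.to i +ᵥ prefix (toℕ k))))
                         (λ i → indicator (member (V.to i +ᵥ prefix (toℕ k) +ᵥ 𝟏))))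
            (cong₂ ℕ._+_ (sum-translate (prefix (toℕ k)))
              (≡.trans
                (sum-cong-≗ {q ^ n} λ i → cong indicator (member-cong λ j →
                  +-assoc (V.to i j) (prefix (toℕ k) j) 1#))
                (sum-translate (prefix (toℕ k) +ᵥ 𝟏)))))
          -- Each rung contributes at most 1 and some rung fails to, hence the bound n - 1.
          (λ i → ℕ.<⇒≤pred (sum<length _ (λ k → rung≤1 (V.to i) (toℕ k)) (not-all-rungs (V.to i))))

-- Stated for an arbitrary graph, so that the search defining α is never unfolded.
α-elim : ∀ {a b ℓ} (G : FiniteGraph a b ℓ) (P : ℕ → Set) →
         (∀ S → FiniteGraph.Independent G S → P ∣ S ∣) → P (α G)
α-elim G P bound with FiniteGraph.independenceNumber-isGreatest G
... | (S , ∣S∣≡α , indep) , _ = ≡.subst P ∣S∣≡α (bound S indep)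

-- From the averaged inequalities to bounds on `α`.

α≤qⁿ⁻¹ : ∀ {c ℓ q} .{{_ : NonZero q}} (F : FiniteField c ℓ q) m → α (Gpr F (suc m)) ≤ q ^ m
α≤qⁿ⁻¹ {q = q} F m = α-elim (Gpr F (suc m)) (_≤ q ^ m) λ S indep →
  ℕ.*-cancelˡ-≤ q (ℕ.≤-trans (line-bound S indep zero) (ℕ.≤-reflexive (ℕ.*-identityʳ _)))
  where open PhaseRotationProperties F (suc m)

α-even-bound : ∀ {c ℓ} (F : FiniteField c ℓ 2) m → 2 ∣ suc m →
               α (Gpr F (suc m)) ℕ.* suc m ≤ 2 ^ m ℕ.* m
α-even-bound F m 2∣n = α-elim (Gpr F (suc m)) (λ s → s ℕ.* suc m ≤ 2 ^ m ℕ.* m) λ S indep →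
  -- The ladder has two points per rung, which gives the factor 2 on the left; on the right it is
  -- split off from the power of two.
  ℕ.*-cancelˡ-≤ 2 (begin
    2 ℕ.* (∣ S ∣ ℕ.* suc m)
      ≡⟨ solve 2 (λ s n → con 2 :* (s :* n) := n :* (s :+ s)) ≡.refl ∣ S ∣ (suc m) ⟩
    suc m ℕ.* (∣ S ∣ ℕ.+ ∣ S ∣)    ≤⟨ ladder-bound S indep (char2 F) 2∣n zero ⟩
    2 ℕ.* 2 ^ m ℕ.* m              ≡⟨ ℕ.*-assoc 2 (2 ^ m) m ⟩
    2 ℕ.* (2 ^ m ℕ.* m)            ∎)
  where
  open PhaseRotationProperties F (suc m)
  open ℕ.≤-Reasoning
  open +-*-Solver

-- Since `_/_` reduces fractions to lowest terms, the comparison is moved to unnormalised rationals,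
-- where it is cross-multiplication of integers.
≤-fraction : ∀ a b c d → a ℕ.* suc d ≤ b ℕ.* c → (+ a / 1) ℚ.≤ (+ b / 1) ℚ.* (+ c / suc d)
≤-fraction a b c d h = ℚ.toℚᵘ-cancel-≤ (begin
  ℚ.toℚᵘ (+ a / 1)                               ≃⟨ ℚ.toℚᵘ-fromℚᵘ (ℚᵘ.mkℚᵘ (+ a) 0) ⟩
  ℚᵘ.mkℚᵘ (+ a) 0                                ≤⟨ ℚᵘ.*≤* cross ⟩
  ℚᵘ.mkℚᵘ (+ b) 0 ℚᵘ.* ℚᵘ.mkℚᵘ (+ c) d
    ≃⟨ ℚᵘ.*-cong (ℚ.toℚᵘ-fromℚᵘ (ℚᵘ.mkℚᵘ (+ b) 0)) (ℚ.toℚᵘ-fromℚᵘ (ℚᵘ.mkℚᵘ (+ c) d)) ⟨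
  ℚ.toℚᵘ (+ b / 1) ℚᵘ.* ℚ.toℚᵘ (+ c / suc d)     ≃⟨ ℚ.toℚᵘ-homo-* (+ b / 1) (+ c / suc d) ⟨
  ℚ.toℚᵘ ((+ b / 1) ℚ.* (+ c / suc d))           ∎)
  where
  open ℚᵘ.≤-Reasoning
  cross : + a ℤ.* (+ 1 ℤ.* + suc d) ℤ.≤ + b ℤ.* + c ℤ.* + 1
  cross = ≡.subst₂ ℤ._≤_
    (≡.trans (ℤ.pos-* a (suc d)) (cong (+ a ℤ.*_) (≡.sym (ℤ.*-identityˡ (+ suc d)))))
    (≡.trans (ℤ.pos-* b c) (≡.sym (ℤ.*-identityʳ (+ b ℤ.* + c))))
    (ℤ.+≤+ h)

theorem37 : ∀ {c ℓ} (q n : ℕ) .{{_ : NonZero n}} → IsPrimePower q → 2 ≤ n → (F : FiniteField c ℓ q) →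
    (q ≡ 2 × 2 ∣ n → (+ α (Gpr F n) / 1) ℚ.≤ (+ (2 ^ (n ∸ 1)) / 1) ℚ.* (+ (n ∸ 1) / n)) ×
    ((q ≡ 2 × ¬ (2 ∣ n)) ⊎ 3 ≤ q → α (Gpr F n) ≤ q ^ (n ∸ 1))
theorem37 q (suc m) _ _ F =
    (λ { (≡.refl , 2∣n) → ≤-fraction (α (Gpr F (suc m))) (2 ^ m) m m (α-even-bound F m 2∣n) })
  , (λ { (inj₁ (≡.refl , _)) → α≤qⁿ⁻¹ F m
       ; (inj₂ 3≤q) → α≤qⁿ⁻¹ {{ℕ.>-nonZero (ℕ.≤-trans (s≤s z≤n) 3≤q)}} F m })
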